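{- For every signed graph $\Sigma$, $$\mathrm{BSTAB}(\Sigma)\subseteq\mathrm{BTH}(\Sigma)\subseteq\mathrm{BQSTAB}(\Sigma).$$
   Context: Signed graphs. A signed graph is a pair $\Sigma=(G,\sigma)$ with $G$ a finite graph and $\sigma:E(G)\to\{+1,-1\}$. Positive loops are allowed, negative loops are excluded; between two distinct vertices there may be both a positive and a negative edge (a digon); repeated edges of the same sign are immaterial. Convention: every signed graph is replaced by its completion having a positive loop at every vertex. A signed graph is balanced if every cycle has positive sign (product of edge signs; a digon is a negative cycle); a set $B\subseteq V(\Sigma)$ is balanced if the induced signed graph $\Sigma[B]$ is balanced. Conflict graph. $C(\Sigma)$ is the ordinary simple graph on $V(\Sigma)\times\{\pm1\}$ with $(u,s)\sim(v,r)$ iff there is an edge $e=uv$ of $\Sigma$ (possibly a loop, $u=v$) with $r=-\sigma(e)s$. In particular $(v,+)\sim(v,-)$ for all $v$. Ordinary bodies. For a finite simple graph $H$: $\mathrm{STAB}(H)=\operatorname{conv}\{\mathbf 1_I: I\text{ stable in }H\}$; $\mathrm{QSTAB}(H)=\{x\ge0: x(K)\le1\text{ for every clique }K\}$, with $x(K)=\sum_{v\in K}x_v$; $\mathrm{TH}(H)=\{x:\exists\, X\text{ symmetric with }\begin{pmatrix} 1 & x^{\mathsf T} \\ x & X \end{pmatrix}\succeq0,\ \operatorname{diag}X=x,\ X_{uv}=0\ (uv\in E(H))\}$. Signed bodies. Let $p:\mathbb R^{V(\Sigma)\times\{\pm1\}}\to\mathbb R^{V(\Sigma)}$, $p(y)_v=y_{(v,+)}+y_{(v,-)}$.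 Then $\mathrm{BSTAB}(\Sigma)=\operatorname{conv}\{\mathbf 1_B:B\subseteq V(\Sigma)\text{ balanced}\}$, $\mathrm{BTH}(\Sigma)=p(\mathrm{TH}(C(\Sigma)))$, and $\mathrm{BQSTAB}(\Sigma)=p(\mathrm{QSTAB}(C(\Sigma)))$. -}

module Defs where

open import Level using (Level; _⊔_; 0ℓ) renaming (suc to lsuc)
open import Algebra.Bundles using (CommutativeRing)
open import Algebra.Apartness.Bundles using (HeytingField; HeytingCommutativeRing)
import Algebra.Definitions.RawMonoid as RawMonoidDefs
import Algebra.Properties.CommutativeMonoid.Sum as MonoidSum
open import Data.Bool.Base using (Bool; T; if_then_else_)
open import Data.Fin.Base using (Fin)
open import Data.Fin.Properties using (1↔⊤; +↔⊎; *↔×)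
open import Data.List.Base using (List; []; _∷_)
open import Data.List.Relation.Unary.Unique.Propositional using (Unique)
open import Data.Nat.Base as ℕ using (ℕ)
open import Data.Product.Base using (∃-syntax; Σ-syntax; _×_; _,_; proj₁; proj₂)
open import Data.Product.Function.NonDependent.Propositional using (_×-↔_)
open import Data.Sign.Base as Sign using (Sign; opposite)
import Data.Sign.Properties as Signₚ
open import Data.Sum.Base using (_⊎_; inj₁; inj₂; [_,_]′)
open import Data.Sum.Function.Propositional using (_⊎-↔_)
open import Data.Unit.Base using (⊤; tt)
open import Function.Base using (_∘_)
open import Function.Bundles using (_↔_; _⇔_; Inverse; mk↔ₛ′)
open import Function.Construct.Composition using (_↔-∘_)
open import Function.Construct.Identity using (↔-id)
open import Relation.Binary.Core using (Rel)
open import Relation.Binary.Definitions using (Symmetric)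
open import Relation.Binary.PropositionalEquality.Core using (_≡_; _≢_; refl; sym; trans; cong)
open import Relation.Binary.Structures using (IsStrictPartialOrder)
open import Relation.Nullary.Negation.Core using (¬_)
open import Relation.Unary using (Pred)

------------------------------------------------------------------------
-- The real numbers

-- ℝ is axiomatised as a Cauchy complete Archimedean ordered field.
-- Classically these axioms are equivalent to being a Dedekind complete
-- ordered field, and so determine ℝ up to isomorphism.  They are phrased
-- so that they also make sense constructively: no decidability of _<_ is
-- assumed, and apartness, not inequality, is what gives an inverse.

record RealField c ℓ₁ ℓ₂ : Set (lsuc (c ⊔ ℓ₁ ⊔ ℓ₂)) where
  infix 4 _<_ _≤_
  field
    heytingField : HeytingField c ℓ₁ ℓ₂

  open HeytingField heytingField public

  commutativeRing : CommutativeRing c ℓ₁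
  commutativeRing = HeytingCommutativeRing.commutativeRing heytingCommutativeRing

  open CommutativeRing commutativeRing public using (+-rawMonoid; +-commutativeMonoid)
  open RawMonoidDefs +-rawMonoid public using () renaming (_×_ to _·_)

  field
    _<_                  : Rel Carrier ℓ₂
    isStrictPartialOrder : IsStrictPartialOrder _≈_ _<_
    #⇔<⊎>                : ∀ {x y} → x # y ⇔ (x < y ⊎ y < x)
    +-monoʳ-<            : ∀ z {x y} → x < y → z + x < z + y
    *-pos                : ∀ {x y} → 0# < x → 0# < y → 0# < x * y
    archimedean          : ∀ x → ∃[ n ] x < n · 1#

  -- A bound a m - a n < ε for all large m and n bounds |a m - a n|, since
  -- m and n can be exchanged.
  IsCauchy : (ℕ → Carrier) → Set (c ⊔ ℓ₂)
  IsCauchy a = ∀ ε → 0# < ε →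
    ∃[ N ] (∀ m n → N ℕ.≤ m → N ℕ.≤ n → a m - a n < ε)

  _ConvergesTo_ : (ℕ → Carrier) → Carrier → Set (c ⊔ ℓ₂)
  a ConvergesTo l = ∀ ε → 0# < ε →
    ∃[ N ] (∀ n → N ℕ.≤ n → (a n - l < ε) × (l - a n < ε))

  field
    complete : ∀ a → IsCauchy a → ∃[ l ] a ConvergesTo l

  _≤_ : Rel Carrier ℓ₂
  x ≤ y = ¬ (y < x)

------------------------------------------------------------------------
-- Finite types

record Finite (A : Set) : Set where
  field
    size        : ℕ
    enumeration : Fin size ↔ A

open Finite {{...}} public

instance
  finite-Fin : ∀ {n} → Finite (Fin n)
  finite-Fin {n} = record { size = n ; enumeration = ↔-id (Fin n) }

  finite-⊤ : Finite ⊤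
  finite-⊤ = record { size = 1 ; enumeration = 1↔⊤ }

  finite-Sign : Finite Sign
  finite-Sign = record
    { size        = 2
    ; enumeration = mk↔ₛ′
        (λ { Fin.zero → Sign.+ ; (Fin.suc Fin.zero) → Sign.- })
        (λ { Sign.+ → Fin.zero ; Sign.- → Fin.suc Fin.zero })
        (λ { Sign.+ → refl ; Sign.- → refl })
        (λ { Fin.zero → refl ; (Fin.suc Fin.zero) → refl })
    }

  finite-⊎ : ∀ {A B : Set} {{_ : Finite A}} {{_ : Finite B}} → Finite (A ⊎ B)
  finite-⊎ {A} {B} = record
    { size        = size {A} ℕ.+ size {B}
    ; enumeration = (enumeration ⊎-↔ enumeration) ↔-∘ +↔⊎
    }

  finite-× : ∀ {A B : Set} {{_ : Finite A}} {{_ : Finite B}} → Finite (A × B)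
  finite-× {A} {B} = record
    { size        = size {A} ℕ.* size {B}
    ; enumeration = (enumeration ×-↔ enumeration) ↔-∘ *↔×
    }

------------------------------------------------------------------------
-- Signed graphs

-- Parallel edges, of equal or of opposite sign, are allowed.
-- The order of the two ends of an edge carries no meaning.

record SignedGraph (V E : Set) : Set where
  field
    ends           : E → V × V
    σ              : E → Sign
    noNegativeLoop : ∀ e → proj₁ (ends e) ≡ proj₂ (ends e) → σ e ≡ Sign.+

  Joins : E → V → V → Set
  Joins e u v = (ends e ≡ (u , v)) ⊎ (ends e ≡ (v , u))

  data Walk : V → V → Set where
    []     : ∀ {v} → Walk v v
    _∷⟨_⟩_ : ∀ {u v w} (e : E) → Joins e u v → Walk v w → Walk u w

  sign : ∀ {u v} → Walk u v → Sign
  sign []            = Sign.+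
  sign (e ∷⟨ _ ⟩ w) = σ e Sign.* sign w

  edges : ∀ {u v} → Walk u v → List E
  edges []            = []
  edges (e ∷⟨ _ ⟩ w) = e ∷ edges w

  -- All vertices of a walk except its final one.
  starts : ∀ {u v} → Walk u v → List V
  starts []                = []
  starts {u} (_ ∷⟨ _ ⟩ w) = u ∷ starts w

  -- Cycles of length one are loops, cycles of length two are pairs of
  -- distinct parallel edges.
  record IsCycle {v : V} (w : Walk v v) : Set where
    field
      nonEmpty         : edges w ≢ []
      distinctEdges    : Unique (edges w)
      distinctVertices : Unique (starts w)

  Balanced : Set
  Balanced = ∀ {v} (w : Walk v v) → IsCycle w → sign w ≡ Sign.+

module _ {V E : Set} (Σ : SignedGraph V E) where
  open SignedGraph Σ

  completion : SignedGraph V (E ⊎ V)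
  completion = record
    { ends           = [ ends , (λ v → v , v) ]′
    ; σ              = [ σ , (λ _ → Sign.+) ]′
    ; noNegativeLoop = λ { (inj₁ e) → noNegativeLoop e ; (inj₂ _) _ → refl }
    }

  induced : (B : V → Bool) →
            SignedGraph (∃[ v ] T (B v))
                        (∃[ e ] (T (B (proj₁ (ends e))) × T (B (proj₂ (ends e)))))
  induced B = record
    { ends           = λ (e , p , q) → (proj₁ (ends e) , p) , (proj₂ (ends e) , q)
    ; σ              = λ (e , _) → σ e
    ; noNegativeLoop = λ (e , _) eq → noNegativeLoop e (cong proj₁ eq)
    }

  BalancedSet : (V → Bool) → Set
  BalancedSet B = SignedGraph.Balanced (induced B)

------------------------------------------------------------------------
-- Simple graphs and the conflict graph

record SimpleGraph (V : Set) : Set₁ where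
  infix 4 _∼_
  field
    _∼_    : Rel V 0ℓ
    ∼-sym  : Symmetric _∼_
    ∼-irr  : ∀ v → ¬ (v ∼ v)

  IsClique : (V → Bool) → Set
  IsClique K = ∀ u v → T (K u) → T (K v) → u ≢ v → u ∼ v

module _ {V E : Set} (Σ : SignedGraph V E) where
  open SignedGraph Σ

  Conflict : Rel (V × Sign) 0ℓ
  Conflict (u , s) (v , r) = ∃[ e ] (Joins e u v × r ≡ opposite (σ e) Sign.* s)

  private
    flipSign : ∀ t {s r} → r ≡ opposite t Sign.* s → s ≡ opposite t Sign.* r
    flipSign Sign.+ {Sign.+} refl = refl
    flipSign Sign.+ {Sign.-} refl = refl
    flipSign Sign.-          refl = refl

    flipJoins : ∀ {e u v} → Joins e u v → Joins e v u
    flipJoins = [ inj₂ , inj₁ ]′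

    loop : ∀ {e v} → Joins e v v → σ e ≡ Sign.+
    loop {e} = [ isLoop , isLoop ]′
      where
      isLoop : ∀ {v} → ends e ≡ (v , v) → σ e ≡ Sign.+
      isLoop eq = noNegativeLoop e (trans (cong proj₁ eq) (sym (cong proj₂ eq)))

  conflictGraph : SimpleGraph (V × Sign)
  conflictGraph = record
    { _∼_   = Conflict
    ; ∼-sym = λ (e , j , eq) → e , flipJoins j , flipSign (σ e) eq
    ; ∼-irr = λ (_ , s) (e , j , eq) →
        Signₚ.s≢opposite[s] s (trans eq (cong (λ t → opposite t Sign.* s) (loop j)))
    }

------------------------------------------------------------------------
-- The convex bodies

module Bodies {c ℓ₁ ℓ₂} (ℝ : RealField c ℓ₁ ℓ₂) where
  open RealField ℝ
  open MonoidSum +-commutativeMonoid using (sum)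

  -- The vectors of ℝ^A.  They are compared pointwise up to _≈_.
  Vec : Set → Set c
  Vec A = A → Carrier

  Matrix : Set → Set c
  Matrix A = A → A → Carrier

  ∑ : {A : Set} {{_ : Finite A}} → Vec A → Carrier
  ∑ f = sum (f ∘ Inverse.to enumeration)

  𝟙 : {A : Set} → (A → Bool) → Vec A
  𝟙 B v = if B v then 1# else 0#

  conv : ∀ {ℓ} {A : Set} → Pred (Vec A) ℓ → Pred (Vec A) (c ⊔ ℓ₁ ⊔ ℓ₂ ⊔ ℓ)
  conv {A = A} P x =
    Σ[ k ∈ ℕ ] Σ[ λs ∈ Vec (Fin k) ] Σ[ points ∈ (Fin k → Vec A) ]
      (∀ i → P (points i))
      × (∀ i → 0# ≤ λs i)
      × ∑ λs ≈ 1#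
      × (∀ v → x v ≈ ∑ (λ i → λs i * points i v))

  IsSymmetric : {A : Set} → Matrix A → Set ℓ₁
  IsSymmetric M = ∀ i j → M i j ≈ M j i

  record PositiveSemidefinite {A : Set} {{_ : Finite A}} (M : Matrix A) : Set (c ⊔ ℓ₁ ⊔ ℓ₂) where
    field
      symmetric   : IsSymmetric M
      nonNegative : ∀ (z : Vec A) → 0# ≤ ∑ (λ i → ∑ (λ j → z i * M i j * z j))

  bordered : {A : Set} → Vec A → Matrix A → Matrix (⊤ ⊎ A)
  bordered x X (inj₁ _) (inj₁ _) = 1#
  bordered x X (inj₁ _) (inj₂ v) = x v
  bordered x X (inj₂ u) (inj₁ _) = x u
  bordered x X (inj₂ u) (inj₂ v) = X u v

  module _ {V : Set} {{_ : Finite V}} (H : SimpleGraph V) where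
    open SimpleGraph H

    QSTAB : Pred (Vec V) ℓ₂
    QSTAB x =
      (∀ v → 0# ≤ x v)
      × (∀ K → IsClique K → ∑ (λ v → if K v then x v else 0#) ≤ 1#)

    TH : Pred (Vec V) (c ⊔ ℓ₁ ⊔ ℓ₂)
    TH x = Σ[ X ∈ Matrix V ]
      IsSymmetric X
      × PositiveSemidefinite (bordered x X)
      × (∀ v → X v v ≈ x v)
      × (∀ u v → u ∼ v → X u v ≈ 0#)

  proj : {V : Set} → Vec (V × Sign) → Vec V
  proj y v = y (v , Sign.+) + y (v , Sign.-)

  projImage : ∀ {ℓ} {V : Set} → Pred (Vec (V × Sign)) ℓ → Pred (Vec V) (c ⊔ ℓ₁ ⊔ ℓ)
  projImage P x = ∃[ y ] (P y × (∀ v → proj y v ≈ x v))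

  module _ {V E : Set} {{_ : Finite V}} (Σ : SignedGraph V E) where

    BSTAB : Pred (Vec V) (c ⊔ ℓ₁ ⊔ ℓ₂)
    BSTAB = conv (λ z → ∃[ B ] (BalancedSet Σ B × (∀ v → z v ≈ 𝟙 B v)))

    BTH : Pred (Vec V) (c ⊔ ℓ₁ ⊔ ℓ₂)
    BTH = projImage (TH (conflictGraph Σ))

    BQSTAB : Pred (Vec V) (c ⊔ ℓ₁ ⊔ ℓ₂)
    BQSTAB = projImage (QSTAB (conflictGraph Σ))

{-# OPTIONS --safe #-}

-- A balanced set B has a potential: signs s on B with σ(uv) = s(u) s(v) on
-- every edge inside B (Harary).  The set {(v , s v) : v ∈ B} is then stable in
-- the conflict graph and projects onto B, so BSTAB lies in the projection of
-- STAB.  STAB ⊆ TH because Σᵢ λᵢ (1 , χᵢ)(1 , χᵢ)ᵀ is positive semidefinite,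
-- and TH ⊆ QSTAB by evaluating the quadratic form at (1 , -χ_K) for a clique K.
--
-- The potential is built by adding the edges one at a time, keeping for any
-- two vertices in the same component a simple path between them.  A new edge
-- inside a component closes such a path to a cycle, so balance gives its sign;
-- a new edge between two components is absorbed by switching one of them.

module Submission where

open import Algebra.Bundles using (CommutativeRing)
import Algebra.Properties.CommutativeSemigroup as CommutativeSemigroupₚ
import Algebra.Properties.Ring as Ringₚ
import Algebra.Properties.Semiring.Sum as SemiringSum
open import Data.Bool.Base using (Bool; true; false; T; _∧_; if_then_else_)
open import Data.Bool.Properties using (T?; T-irrelevant; T-∧)
open import Data.Fin.Base using (Fin; punchIn)
import Data.Fin.Properties as Finₚ
open import Data.List.Base using (List; []; _∷_; _++_; map; allFin; concatMap)
import Data.List.Membership.DecPropositional as DecMembership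
open import Data.List.Membership.Propositional using (_∈_; _∉_)
open import Data.List.Membership.Propositional.Properties
  using (∈-map⁺; ∈-allFin; ∈-concatMap⁺; ∈-++⁻)
open import Data.List.Relation.Unary.All as All using (All; []; _∷_)
import Data.List.Relation.Unary.All.Properties as Allₚ
open import Data.List.Relation.Unary.AllPairs using ([]; _∷_)
open import Data.List.Relation.Unary.Any as Any using (here; there)
open import Data.List.Relation.Unary.Unique.Propositional using (Unique)
import Data.List.Relation.Unary.Unique.Propositional.Properties as Unique
open import Data.Nat.Base using (suc)
open import Data.Product.Base using (∃-syntax; _×_; _,_; proj₁; proj₂)
open import Data.Product.Properties using (≡-dec)
open import Data.Sign.Base as Sign using (Sign; opposite)
import Data.Sign.Properties as Signₚ
open import Data.Sum.Base using (_⊎_; inj₁; inj₂)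
open import Data.Unit.Base using (⊤; tt)
open import Function.Base using (_∘_; id)
open import Function.Bundles using (Inverse; Equivalence)
open import Function.Construct.Symmetry using (↔-sym)
open import Function.Properties.Inverse using (↔⇒↣)
open import Level using (_⊔_)
open import Relation.Binary.Definitions using (DecidableEquality)
open import Relation.Binary.PropositionalEquality as ≡ using (_≡_; _≢_; module ≡-Reasoning)
import Relation.Binary.Reasoning.Setoid as SetoidReasoning
open import Relation.Binary.Structures using (IsStrictPartialOrder)
open import Relation.Nullary.Decidable
  using (Dec; yes; no; does; ⌊_⌋; toWitness; via-injection; _×-dec_)
open import Relation.Nullary.Irrelevant using (Irrelevant)
open import Relation.Nullary.Negation using (¬_; contradiction)
open import Relation.Unary using (Pred; _⊆_)
open import Defs

-- Balanced signed graphs have potentials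

≟-finite : {A : Set} {{_ : Finite A}} → DecidableEquality A
≟-finite = via-injection (↔⇒↣ (↔-sym enumeration)) Finₚ._≟_

elements : (A : Set) {{_ : Finite A}} → List A
elements A = map (Inverse.to enumeration) (allFin (size {A}))

∈-elements : {A : Set} {{_ : Finite A}} (a : A) → a ∈ elements A
∈-elements {A} a = ≡.subst (_∈ elements A) (Inverse.strictlyInverseˡ enumeration a)
  (∈-map⁺ (Inverse.to enumeration) (∈-allFin (Inverse.from enumeration a)))

module _ {A : Set} {P : A → Set} (P? : ∀ a → Dec (P a)) where

  -- The decision is a separate argument so that `∈-witnesses` can split on it.
  witnesses : ∀ a → Dec (P a) → List (∃[ a ] P a)
  witnesses a (yes p) = (a , p) ∷ []
  witnesses a (no _)  = []

  subtype : List A → List (∃[ a ] P a)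
  subtype = concatMap (λ a → witnesses a (P? a))

  -- The list stores the proof returned by `P?`; irrelevance identifies it with the given `p`.
  ∈-subtype : (∀ {a} → Irrelevant (P a)) →
              ∀ {xs a} → a ∈ xs → (p : P a) → (a , p) ∈ subtype xs
  ∈-subtype irr {a = a} a∈xs p =
    ∈-concatMap⁺ (λ a → witnesses a (P? a)) (Any.map (λ { ≡.refl → ∈-witnesses (P? a) }) a∈xs)
    where
    ∈-witnesses : ∀ a? → (a , p) ∈ witnesses a a?
    ∈-witnesses (yes q) = here (≡.cong (a ,_) (irr p q))
    ∈-witnesses (no ¬p) = contradiction p ¬p

-- Walks, simple paths and components of a set of edges

module _ {V E : Set} (G : SignedGraph V E) where
  open SignedGraph G

  infixr 5 _++ʷ_

  _++ʷ_ : ∀ {u v w} → Walk u v → Walk v w → Walk u w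
  []             ++ʷ q = q
  (e ∷⟨ j ⟩ p) ++ʷ q = e ∷⟨ j ⟩ (p ++ʷ q)

  edges-++ : ∀ {u v w} (p : Walk u v) (q : Walk v w) → edges (p ++ʷ q) ≡ edges p ++ edges q
  edges-++ []             q = ≡.refl
  edges-++ (e ∷⟨ _ ⟩ p) q = ≡.cong (e ∷_) (edges-++ p q)

  starts-++ : ∀ {u v w} (p : Walk u v) (q : Walk v w) → starts (p ++ʷ q) ≡ starts p ++ starts q
  starts-++ []                 q = ≡.refl
  starts-++ {u} (_ ∷⟨ _ ⟩ p) q = ≡.cong (u ∷_) (starts-++ p q)

  joins-swap : ∀ {e u v} → Joins e u v → Joins e v u
  joins-swap (inj₁ eq) = inj₂ eq
  joins-swap (inj₂ eq) = inj₁ eq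

  -- The final vertex is kept apart from `starts`, so prepending an edge from `v` to `u` closes the
  -- path to a cycle in the form that `IsCycle` asks for. A path from a vertex to itself is
  -- therefore empty, which makes the closed cycle a loop.
  record Path (F : List E) (u v : V) : Set where
    field
      walk             : Walk u v
      within           : All (_∈ F) (edges walk)
      distinctEdges    : Unique (edges walk)
      distinctVertices : Unique (starts walk)
      end∉starts       : v ∉ starts walk

  weaken : ∀ {F u v} e → Path F u v → Path (e ∷ F) u v
  weaken e p = record { Path p ; within = All.map there (Path.within p) }

  IsPotential : (V → Sign) → List E → Set
  IsPotential s F = ∀ {e u v} → e ∈ F → Joins e u v → σ e ≡ s u Sign.* s v

  -- Components are encoded by labels in `V`, of which only equality matters: `component-edge` and
  -- `path` together say that equal labels mean connected through `F`.
  record Components (F : List E) : Set where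
    field
      component      : V → V
      component-edge : ∀ {e u v} → e ∈ F → Joins e u v → component u ≡ component v
      path           : ∀ {u v} → component u ≡ component v → Path F u v
      potential      : V → Sign
      isPotential    : IsPotential potential F

    component-starts : ∀ {u v} (w : Walk u v) → All (_∈ F) (edges w) →
                       All (λ x → component x ≡ component v) (starts w)
    component-start  : ∀ {u v} (w : Walk u v) → All (_∈ F) (edges w) →
                       component u ≡ component v

    component-starts []             []         = []
    component-starts (e ∷⟨ j ⟩ w) (e∈F ∷ w∈F) =
      component-start (e ∷⟨ j ⟩ w) (e∈F ∷ w∈F) ∷ component-starts w w∈F

    component-start []             []         = ≡.refl
    component-start (e ∷⟨ j ⟩ w) (e∈F ∷ w∈F) =
      ≡.trans (component-edge e∈F j) (component-start w w∈F)

    -- An edge is located by its first end, a choice independent of the direction in which the walk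
    -- crosses it. `bridge` uses this to see that paths in different components share no edge.
    component-edges : ∀ {u v} (w : Walk u v) → All (_∈ F) (edges w) →
                      All (λ e → component (proj₁ (ends e)) ≡ component v) (edges w)
    component-edges []             []         = []
    component-edges (e ∷⟨ j ⟩ w) (e∈F ∷ w∈F) =
      firstEnd j ∷ component-edges w w∈F
      where
      firstEnd : Joins e _ _ → component (proj₁ (ends e)) ≡ component _
      firstEnd (inj₁ eq) = ≡.trans (≡.cong (component ∘ proj₁) eq)
        (component-start (e ∷⟨ j ⟩ w) (e∈F ∷ w∈F))
      firstEnd (inj₂ eq) = ≡.trans (≡.cong (component ∘ proj₁) eq) (component-start w w∈F)

    -- The product telescopes: the potential of every inner vertex occurs twice and squares to `+`.
    sign-walk : ∀ {u v} (w : Walk u v) → All (_∈ F) (edges w) →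
                sign w ≡ potential u Sign.* potential v
    sign-walk {u} []         []         = ≡.sym (Signₚ.s*s≡+ (potential u))
    sign-walk {u} {v} (_∷⟨_⟩_ {v = x} e j w) (e∈F ∷ w∈F) = begin
      σ e Sign.* sign w            ≡⟨ ≡.cong₂ Sign._*_ (isPotential e∈F j) (sign-walk w w∈F) ⟩
      (s u Sign.* s x) Sign.* (s x Sign.* s v)  ≡⟨ cancel (s u) (s x) (s v) ⟩
      s u Sign.* s v               ∎
      where
      open ≡-Reasoning
      s = potential
      cancel : ∀ a b c → (a Sign.* b) Sign.* (b Sign.* c) ≡ a Sign.* c
      cancel Sign.+ Sign.+ c = ≡.refl
      cancel Sign.+ Sign.- Sign.+ = ≡.refl
      cancel Sign.+ Sign.- Sign.- = ≡.refl
      cancel Sign.- Sign.+ c = ≡.refl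
      cancel Sign.- Sign.- Sign.+ = ≡.refl
      cancel Sign.- Sign.- Sign.- = ≡.refl

    -- The path from `x` to `u` and the path from `v` to `y` lie in different components, so they
    -- have no vertex or edge in common, and `e` is on neither of them because it is not in `F`.
    -- Their concatenation through `e` is thus again simple.
    bridge : ∀ {e u v x y} → e ∉ F → Joins e u v → component u ≢ component v →
             component x ≡ component u → component v ≡ component y →
             Path (e ∷ F) x y
    bridge {e} {u} {v} {x} {y} e∉F j u≁v x∼u v∼y = record
      { walk             = p.walk ++ʷ (e ∷⟨ j ⟩ q.walk)
      ; within           = ≡.subst (All (_∈ (e ∷ F))) (≡.sym edges≡)
          (Allₚ.++⁺ (All.map there p.within) (here ≡.refl ∷ All.map there q.within))
      ; distinctEdges    = ≡.subst Unique (≡.sym edges≡)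
          (Unique.++⁺ p.distinctEdges (Allₚ.¬Any⇒All¬ _ (e∉F ∘ All.lookup q.within) ∷ q.distinctEdges)
            λ { (e∈p , here ≡.refl)  → e∉F (All.lookup p.within e∈p)
              ; (f∈p , there f∈q) → u≁y (≡.trans
                  (≡.sym (All.lookup (component-edges p.walk p.within) f∈p))
                  (All.lookup (component-edges q.walk q.within) f∈q)) })
      ; distinctVertices = ≡.subst Unique (≡.sym starts≡)
          (Unique.++⁺ p.distinctVertices (Allₚ.¬Any⇒All¬ _ u∉q ∷ q.distinctVertices)
            λ { (u∈p , here ≡.refl)  → p.end∉starts u∈p
              ; (z∈p , there z∈q) → u≁y (≡.trans (≡.sym (in-p z∈p)) (in-q z∈q)) })
      ; end∉starts       = y∉starts ∘ ∈-++⁻ (starts p.walk) ∘ ≡.subst (y ∈_) starts≡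
      }
      where
      module p = Path (path x∼u)
      module q = Path (path v∼y)
      edges≡  = edges-++ p.walk (e ∷⟨ j ⟩ q.walk)
      starts≡ = starts-++ p.walk (e ∷⟨ j ⟩ q.walk)

      u≁y : component u ≢ component y
      u≁y u∼y = u≁v (≡.trans u∼y (≡.sym v∼y))

      in-p : ∀ {z} → z ∈ starts p.walk → component z ≡ component u
      in-p = All.lookup (component-starts p.walk p.within)

      in-q : ∀ {z} → z ∈ starts q.walk → component z ≡ component y
      in-q = All.lookup (component-starts q.walk q.within)

      u∉q : u ∉ starts q.walk
      u∉q = u≁y ∘ in-q

      y∉starts : ¬ (y ∈ starts p.walk ⊎ y ∈ u ∷ starts q.walk)
      y∉starts (inj₁ y∈p)         = u≁y (≡.sym (in-p y∈p))
      y∉starts (inj₂ (here ≡.refl)) = u≁y ≡.refl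
      y∉starts (inj₂ (there y∈q)) = q.end∉starts y∈q


    -- Following `e` by the path from `v` back to `u` gives a cycle. Balance forces `e` to have the
    -- sign of that path, which `sign-walk` expresses by the potentials of the two ends.
    close : Balanced → ∀ {e u v} → e ∉ F → Joins e u v → component u ≡ component v →
            σ e ≡ potential u Sign.* potential v
    close balanced {e} {u} {v} e∉F j u∼v = begin
      σ e                    ≡⟨ Signₚ.*-cancelʳ-≡ (sign p.walk) (σ e) (sign p.walk) e*p≡p*p ⟩
      sign p.walk            ≡⟨ sign-walk p.walk p.within ⟩
      potential v Sign.* potential u  ≡⟨ Signₚ.*-comm (potential v) (potential u) ⟩
      potential u Sign.* potential v  ∎
      where
      open ≡-Reasoning
      module p = Path (path (≡.sym u∼v))
      cycle : IsCycle (e ∷⟨ j ⟩ p.walk)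
      cycle = record
        { nonEmpty         = λ ()
        ; distinctEdges    = Allₚ.¬Any⇒All¬ _ (e∉F ∘ All.lookup p.within) ∷ p.distinctEdges
        ; distinctVertices = Allₚ.¬Any⇒All¬ _ p.end∉starts ∷ p.distinctVertices
        }
      -- Both products are `+`: the left one by balance, the right one as a square.
      e*p≡p*p : σ e Sign.* sign p.walk ≡ sign p.walk Sign.* sign p.walk
      e*p≡p*p = ≡.trans (balanced (e ∷⟨ j ⟩ p.walk) cycle) (≡.sym (Signₚ.s*s≡+ (sign p.walk)))

  -- Adding one edge: inside a component or between two

  module _ (_≟ⱽ_ : DecidableEquality V) {F : List E} (C : Components F)
           {e u v} (e∉F : e ∉ F) (ends-e : ends e ≡ (u , v)) where
    open Components C

    private
      ends-unique : ∀ {a b} → Joins e a b → (a ≡ u × b ≡ v) ⊎ (a ≡ v × b ≡ u)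
      ends-unique (inj₁ eq) with ≡.refl ← ≡.trans (≡.sym ends-e) eq = inj₁ (≡.refl , ≡.refl)
      ends-unique (inj₂ eq) with ≡.refl ← ≡.trans (≡.sym ends-e) eq = inj₂ (≡.refl , ≡.refl)

    addChord : Balanced → component u ≡ component v → Components (e ∷ F)
    addChord balanced u∼v = record
      { component      = component
      ; component-edge = component-edge′
      ; path           = weaken e ∘ path
      ; potential      = potential
      ; isPotential    = isPotential′
      }
      where
      component-edge′ : ∀ {f a b} → f ∈ e ∷ F → Joins f a b → component a ≡ component b
      component-edge′ (there f∈F) j = component-edge f∈F j
      component-edge′ (here ≡.refl) j with ends-unique j
      ... | inj₁ (≡.refl , ≡.refl) = u∼v
      ... | inj₂ (≡.refl , ≡.refl) = ≡.sym u∼v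

      isPotential′ : IsPotential potential (e ∷ F)
      isPotential′ (there f∈F) j = isPotential f∈F j
      isPotential′ (here ≡.refl) j = close balanced e∉F j (component-edge′ (here ≡.refl) j)

    addBridge : component u ≢ component v → Components (e ∷ F)
    addBridge u≁v = record
      { component      = merged ∘ component
      ; component-edge = component-edge′
      ; path           = path′
      ; potential      = potential′
      ; isPotential    = isPotential′
      }
      where
      j₀ : Joins e u v
      j₀ = inj₁ ends-e

      -- The component of `v` takes over the label of the component of `u`.
      merged : V → V
      merged c = if does (c ≟ⱽ component v) then component u else c

      merged-u≡merged-v : merged (component u) ≡ merged (component v)
      merged-u≡merged-v with component u ≟ⱽ component v | component v ≟ⱽ component v
      ... | _     | no v≁v = contradiction ≡.refl v≁v
      ... | yes _ | yes _  = ≡.refl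
      ... | no _  | yes _  = ≡.refl

      component-edge′ : ∀ {f a b} → f ∈ e ∷ F → Joins f a b →
                        merged (component a) ≡ merged (component b)
      component-edge′ (there f∈F) j = ≡.cong merged (component-edge f∈F j)
      component-edge′ (here ≡.refl) j with ends-unique j
      ... | inj₁ (≡.refl , ≡.refl) = merged-u≡merged-v
      ... | inj₂ (≡.refl , ≡.refl) = ≡.sym merged-u≡merged-v

      path′ : ∀ {x y} → merged (component x) ≡ merged (component y) → Path (e ∷ F) x y
      path′ {x} {y} x∼y with component x ≟ⱽ component v | component y ≟ⱽ component v
      ... | yes x∼v | yes y∼v = weaken e (path (≡.trans x∼v (≡.sym y∼v)))
      -- Here `x∼y` has reduced to an equality between the labels of `u` and `y`, so the bridge is
      -- crossed from `v` to `u`.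
      ... | yes x∼v | no  _   = bridge e∉F (joins-swap j₀) (u≁v ∘ ≡.sym) x∼v x∼y
      ... | no  _   | yes y∼v = bridge e∉F j₀ u≁v x∼y (≡.sym y∼v)
      ... | no  _   | no  _   = weaken e (path x∼y)

      -- The factor on the component of `v` is the discrepancy between `σ e` and the product of the
      -- old potentials, so it is `+` exactly when `e` already fits.
      switch : V → Sign
      switch c = if does (c ≟ⱽ component v) then σ e Sign.* (potential u Sign.* potential v) else Sign.+

      potential′ : V → Sign
      potential′ x = switch (component x) Sign.* potential x

      -- For an old edge both ends lie in one component and receive the same factor `t`, which
      -- squares to `+`.
      switch-twice : ∀ t a b → (t Sign.* a) Sign.* (t Sign.* b) ≡ a Sign.* b
      switch-twice Sign.+ a      b      = ≡.refl
      switch-twice Sign.- Sign.+ b      = Signₚ.opposite-involutive b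
      switch-twice Sign.- Sign.- Sign.+ = ≡.refl
      switch-twice Sign.- Sign.- Sign.- = ≡.refl

      switch-end : ∀ t a b → t ≡ a Sign.* ((t Sign.* (a Sign.* b)) Sign.* b)
      switch-end Sign.+ Sign.+ Sign.+ = ≡.refl
      switch-end Sign.+ Sign.+ Sign.- = ≡.refl
      switch-end Sign.+ Sign.- Sign.+ = ≡.refl
      switch-end Sign.+ Sign.- Sign.- = ≡.refl
      switch-end Sign.- Sign.+ Sign.+ = ≡.refl
      switch-end Sign.- Sign.+ Sign.- = ≡.refl
      switch-end Sign.- Sign.- Sign.+ = ≡.refl
      switch-end Sign.- Sign.- Sign.- = ≡.refl

      σ≡ : σ e ≡ potential′ u Sign.* potential′ v
      σ≡ with component u ≟ⱽ component v | component v ≟ⱽ component v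
      ... | yes u∼v | _      = contradiction u∼v u≁v
      ... | no _    | no v≁v = contradiction ≡.refl v≁v
      -- Only `v` is switched, since `u` lies in another component.
      ... | no _    | yes _  = switch-end (σ e) (potential u) (potential v)

      isPotential′ : IsPotential potential′ (e ∷ F)
      isPotential′ {u = a} {v = b} (there f∈F) j = begin
        _                              ≡⟨ isPotential f∈F j ⟩
        potential a Sign.* potential b ≡⟨ switch-twice (switch (component a)) _ _ ⟨
        potential′ a Sign.* (switch (component a) Sign.* potential b)
          ≡⟨ ≡.cong (λ c → potential′ a Sign.* (switch c Sign.* potential b)) (component-edge f∈F j) ⟩
        potential′ a Sign.* potential′ b ∎
        where open ≡-Reasoning
      isPotential′ (here ≡.refl) j with ends-unique j
      ... | inj₁ (≡.refl , ≡.refl) = σ≡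
      ... | inj₂ (≡.refl , ≡.refl) = ≡.trans σ≡ (Signₚ.*-comm (potential′ u) (potential′ v))

  -- Induction over a list of edges

  module _ (_≟ⱽ_ : DecidableEquality V) (_≟ᴱ_ : DecidableEquality E) (balanced : Balanced) where
    open DecMembership _≟ᴱ_ using (_∈?_)

    components : ∀ F → Components F
    components [] = record
      { component      = id
      ; component-edge = λ ()
      ; path           = λ { ≡.refl → record
          { walk = [] ; within = [] ; distinctEdges = [] ; distinctVertices = [] ; end∉starts = λ () } }
      ; potential      = λ _ → Sign.+
      ; isPotential    = λ ()
      }
    components (e ∷ F) with components F | e ∈? F
    -- A repeated edge is absorbed: a path in `F` may already use it, so it could not close such a
    -- path to a cycle.
    ... | C | yes e∈F = record
      { component      = component
      ; component-edge = component-edge ∘ absorb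
      ; path           = weaken e ∘ path
      ; potential      = potential
      ; isPotential    = isPotential ∘ absorb
      }
      where
      open Components C
      absorb : ∀ {f} → f ∈ e ∷ F → f ∈ F
      absorb (here ≡.refl)  = e∈F
      absorb (there f∈F) = f∈F
    ... | C | no e∉F
      with Components.component C (proj₁ (ends e)) ≟ⱽ Components.component C (proj₂ (ends e))
    ...   | yes u∼v = addChord _≟ⱽ_ C e∉F ≡.refl balanced u∼v
    ...   | no  u≁v = addBridge _≟ⱽ_ C e∉F ≡.refl u≁v

    balanced⇒potential : ∀ F → ∃[ s ] IsPotential s F
    balanced⇒potential F = Components.potential C , Components.isPotential C
      where C = components F

-- From balanced sets to stable sets of the conflict graph

module _ {V E : Set} {{_ : Finite V}} {{_ : Finite E}} (G : SignedGraph V E) where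
  open SignedGraph G

  balancedSet⇒potential : ∀ B → BalancedSet G B → ∃[ s ] (∀ {e u v} → T (B u) → T (B v) →
                          Joins e u v → σ e ≡ s u Sign.* s v)
  balancedSet⇒potential B balanced = extend ∘ (λ v → v , T? (B v)) , isPotential
    where
    _≟ⱽ_ : DecidableEquality (∃[ v ] T (B v))
    _≟ⱽ_ = ≡-dec ≟-finite (λ p q → yes (T-irrelevant p q))

    InB : E → Set
    InB e = T (B (proj₁ (ends e))) × T (B (proj₂ (ends e)))

    InB? : ∀ e → Dec (InB e)
    InB? e = T? (B (proj₁ (ends e))) ×-dec T? (B (proj₂ (ends e)))

    InB-irrelevant : ∀ {e} → Irrelevant (InB e)
    InB-irrelevant (p , q) (p′ , q′) = ≡.cong₂ _,_ (T-irrelevant p p′) (T-irrelevant q q′)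

    _≟ᴱ_ : DecidableEquality (∃[ e ] InB e)
    _≟ᴱ_ = ≡-dec ≟-finite (λ p q → yes (InB-irrelevant p q))

    edgesInB : List (∃[ e ] InB e)
    edgesInB = subtype InB? (elements E)

    s : ∃[ v ] T (B v) → Sign
    s = proj₁ (balanced⇒potential (induced G B) _≟ⱽ_ _≟ᴱ_ balanced edgesInB)

    -- The value `+` outside `B` is arbitrary, as only edges with both ends in `B` are constrained.
    -- The vertex is paired with its decision so that `extend≡s` can split on it.
    extend : ∃[ v ] Dec (T (B v)) → Sign
    extend (v , yes p) = s (v , p)
    extend (v , no _)  = Sign.+

    extend≡s : ∀ {v} (v? : Dec (T (B v))) p → extend (v , v?) ≡ s (v , p)
    extend≡s (yes q) p = ≡.cong (λ p → s (_ , p)) (T-irrelevant q p)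
    extend≡s (no ¬p) p = contradiction p ¬p

    isPotential : ∀ {e u v} → T (B u) → T (B v) → Joins e u v →
                  σ e ≡ extend (u , T? (B u)) Sign.* extend (v , T? (B v))
    isPotential {e} {u} {v} p q j = begin
      σ e                      ≡⟨ induced-edge j ⟩
      s (u , p) Sign.* s (v , q) ≡⟨ ≡.cong₂ Sign._*_ (extend≡s (T? (B u)) p) (extend≡s (T? (B v)) q) ⟨
      _                        ∎
      where
      open ≡-Reasoning
      lookup : (b : InB e) → ∀ {x y} → SignedGraph.Joins (induced G B) (e , b) x y →
               σ e ≡ s x Sign.* s y
      lookup b = proj₂ (balanced⇒potential (induced G B) _≟ⱽ_ _≟ᴱ_ balanced edgesInB)
        (∈-subtype InB? InB-irrelevant (∈-elements e) b)
      induced-edge : Joins e u v → σ e ≡ s (u , p) Sign.* s (v , q)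
      induced-edge (inj₁ ≡.refl) = lookup (p , q) (inj₁ ≡.refl)
      -- Membership proofs follow the order of `ends e`, here the reverse of `u`, `v`.
      induced-edge (inj₂ ≡.refl) = lookup (q , p) (inj₂ ≡.refl)

  stableLift : (V → Bool) → (V → Sign) → V × Sign → Bool
  stableLift B s (v , r) = B v ∧ ⌊ s v Signₚ.≟ r ⌋

  -- A conflict between two lifted vertices along an edge `e` says that `s v` is the opposite of
  -- `σ e` times `s u`. Inserting `s u` times `s v` for `σ e` makes `s v` its own opposite.
  balancedSet⇒stable : ∀ B → BalancedSet G B → ∃[ s ] (∀ {a b} → Conflict G a b →
                       T (stableLift B s a) → ¬ T (stableLift B s b))
  balancedSet⇒stable B balanced with s , isPotential ← balancedSet⇒potential B balanced =
    s , stable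
    where
    absurd : ∀ a b → b ≢ opposite (a Sign.* b) Sign.* a
    absurd Sign.+ Sign.+ ()
    absurd Sign.+ Sign.- ()
    absurd Sign.- Sign.+ ()
    absurd Sign.- Sign.- ()

    split : ∀ {v r} → T (stableLift B s (v , r)) → T (B v) × s v ≡ r
    split {v} {r} t with p , q ← Equivalence.to T-∧ t = p , toWitness {a? = s v Signₚ.≟ r} q

    stable : ∀ {a b} → Conflict G a b → T (stableLift B s a) → ¬ T (stableLift B s b)
    stable {u , _} {v , _} (e , j , eq) t t′ with split {u} t | split {v} t′
    ... | p , ≡.refl | q , ≡.refl =
      absurd (s u) (s v) (≡.trans eq (≡.cong (λ σe → opposite σe Sign.* s u) (isPotential p q j)))

-- Convex bodies

module RealProperties {c ℓ₁ ℓ₂} (ℝ : RealField c ℓ₁ ℓ₂) where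
  open RealField ℝ using
    ( Carrier; _<_; _≤_; _#_; commutativeRing; isStrictPartialOrder; tight; #⇔<⊎>
    ; +-monoʳ-<; *-pos)
  open CommutativeRing commutativeRing hiding (Carrier)
  open IsStrictPartialOrder isStrictPartialOrder
    using (<-respʳ-≈; <-respˡ-≈)
    renaming (trans to <-trans; irrefl to <-irrefl)
  open Ringₚ ring using (-‿distribˡ-*; -‿distribʳ-*; -‿involutive)
  open CommutativeSemigroupₚ *-commutativeSemigroup using (x∙yz≈y∙xz)
  open SemiringSum semiring using
    ( sum; sum-cong-≋; sum-replicate-zero; sum-remove; ∑-comm; ∑-distrib-+
    ; *-distribˡ-sum; *-distribʳ-sum)
  open SetoidReasoning setoid
  open Bodies ℝ

  -- Order properties of the reals without trichotomy

  ≤-respʳ-≈ : ∀ {x y z} → y ≈ z → x ≤ y → x ≤ z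
  ≤-respʳ-≈ y≈z x≤y z<x = x≤y (<-respˡ-≈ (sym y≈z) z<x)

  ≤-reflexive : ∀ {x y} → x ≈ y → x ≤ y
  ≤-reflexive x≈y = <-irrefl (sym x≈y)

  -- Apartness is tight, so a negative statement such as _≤_ may be proved
  -- as if _<_ were a trichotomous order.
  nonneg-cases : ∀ {ℓ} {P : Set ℓ} {x} → 0# ≤ x → (0# < x → ¬ P) → (x ≈ 0# → ¬ P) → ¬ P
  nonneg-cases {x = x} 0≤x pos null p = null (proj₁ (tight x 0#) x¬#0) p
    where
    x¬#0 : ¬ x # 0#
    x¬#0 x#0 with Equivalence.to #⇔<⊎> x#0
    ... | inj₁ x<0 = 0≤x x<0
    ... | inj₂ 0<x = pos 0<x p

  +-nonneg : ∀ {x y} → 0# ≤ x → 0# ≤ y → 0# ≤ x + y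
  +-nonneg {x} {y} 0≤x 0≤y = nonneg-cases 0≤x
    (λ 0<x x+y<0 → 0≤y (<-trans
      (<-respʳ-≈ (+-comm y x) (<-respˡ-≈ (+-identityʳ y) (+-monoʳ-< y 0<x))) x+y<0))
    (λ x≈0 x+y<0 → 0≤y (<-respˡ-≈ (trans (+-congʳ x≈0) (+-identityˡ y)) x+y<0))

  *-nonneg : ∀ {x y} → 0# ≤ x → 0# ≤ y → 0# ≤ x * y
  *-nonneg {x} {y} 0≤x 0≤y = nonneg-cases 0≤x
    (λ 0<x → nonneg-cases 0≤y
      (λ 0<y xy<0 → <-irrefl refl (<-trans (*-pos 0<x 0<y) xy<0))
      (λ y≈0 → ≤-reflexive (sym (trans (*-congˡ y≈0) (zeroʳ x)))))
    (λ x≈0 → ≤-reflexive (sym (trans (*-congʳ x≈0) (zeroˡ y))))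

  x<0⇒0<-x : ∀ {x} → x < 0# → 0# < - x
  x<0⇒0<-x {x} x<0 = <-respˡ-≈ (-‿inverseˡ x) (<-respʳ-≈ (+-identityʳ (- x)) (+-monoʳ-< (- x) x<0))

  -x*-y≈x*y : ∀ x y → - x * - y ≈ x * y
  -x*-y≈x*y x y = begin
    - x * - y     ≈⟨ -‿distribˡ-* x (- y) ⟨
    - (x * - y)   ≈⟨ -‿cong (-‿distribʳ-* x y) ⟨
    - - (x * y)   ≈⟨ -‿involutive (x * y) ⟩
    x * y         ∎

  -- The sign of `x` cannot be decided, but under the assumption that the square is negative it is
  -- known: a negative `x` would have the positive square of `- x`. Hence `x` is nonnegative, and
  -- `*-nonneg` gives the contradiction.
  square-nonneg : ∀ x → 0# ≤ x * x
  square-nonneg x x²<0 = *-nonneg 0≤x 0≤x x²<0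
    where
    0≤x : 0# ≤ x
    0≤x x<0 = <-irrefl refl (<-trans
      (<-respʳ-≈ (-x*-y≈x*y x x) (*-pos (x<0⇒0<-x x<0) (x<0⇒0<-x x<0))) x²<0)

  0≤y-x⇒x≤y : ∀ {x y} → 0# ≤ y - x → x ≤ y
  0≤y-x⇒x≤y {x} {y} 0≤y-x y<x = 0≤y-x
    (<-respʳ-≈ (-‿inverseˡ x) (<-respˡ-≈ (+-comm (- x) y) (+-monoʳ-< (- x) y<x)))

  -- Sums over finite types

  module _ {A : Set} {{_ : Finite A}} where

    ∑-cong : {f g : Vec A} → (∀ a → f a ≈ g a) → ∑ f ≈ ∑ g
    ∑-cong f≈g = sum-cong-≋ (λ i → f≈g (Inverse.to enumeration i))

    ∑-congˡ : (h : Vec A) {f g : Vec A} → (∀ a → f a ≈ g a) →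
              ∑ (λ a → h a * f a) ≈ ∑ (λ a → h a * g a)
    ∑-congˡ h {f} {g} f≈g = ∑-cong {λ a → h a * f a} {λ a → h a * g a} (λ a → *-congˡ (f≈g a))

    ∑-zero : {f : Vec A} → (∀ a → f a ≈ 0#) → ∑ f ≈ 0#
    ∑-zero f≈0 = trans (∑-cong f≈0) (sum-replicate-zero (size {A}))

    ∑-+ : (f g : Vec A) → ∑ (λ a → f a + g a) ≈ ∑ f + ∑ g
    ∑-+ f g = ∑-distrib-+ (f ∘ Inverse.to enumeration) (g ∘ Inverse.to enumeration)

    *-∑ : ∀ x (f : Vec A) → x * ∑ f ≈ ∑ (λ a → x * f a)
    *-∑ x f = *-distribˡ-sum x (f ∘ Inverse.to enumeration)

    ∑-* : ∀ x (f : Vec A) → ∑ f * x ≈ ∑ (λ a → f a * x)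
    ∑-* x f = *-distribʳ-sum x (f ∘ Inverse.to enumeration)

    -‿∑ : (f : Vec A) → - ∑ f ≈ ∑ (λ a → - f a)
    -‿∑ f = begin
      - ∑ f                 ≈⟨ -‿cong (*-identityˡ (∑ f)) ⟨
      - (1# * ∑ f)          ≈⟨ -‿distribˡ-* 1# (∑ f) ⟩
      - 1# * ∑ f            ≈⟨ *-∑ (- 1#) f ⟩
      ∑ (λ a → - 1# * f a)  ≈⟨ ∑-cong (λ a → trans (sym (-‿distribˡ-* 1# (f a))) (-‿cong (*-identityˡ (f a)))) ⟩
      ∑ (λ a → - f a)       ∎

    ∑-nonneg : {f : Vec A} → (∀ a → 0# ≤ f a) → 0# ≤ ∑ f
    ∑-nonneg 0≤f = sum-nonneg (λ i → 0≤f (Inverse.to enumeration i))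
      where
      sum-nonneg : ∀ {n} {t : Fin n → Carrier} → (∀ i → 0# ≤ t i) → 0# ≤ sum t
      sum-nonneg {0}     0≤t = ≤-reflexive refl
      sum-nonneg {suc n} 0≤t = +-nonneg (0≤t Fin.zero) (sum-nonneg (0≤t ∘ Fin.suc))

    ∑-swap : {B : Set} {{_ : Finite B}} (f : A → B → Carrier) →
             ∑ (λ a → ∑ (f a)) ≈ ∑ (λ b → ∑ (λ a → f a b))
    ∑-swap f = ∑-comm (λ i j → f (Inverse.to enumeration i) (Inverse.to enumeration j))

    ∑-single : (f : Vec A) (a : A) → (∀ b → b ≢ a → f b ≈ 0#) → ∑ f ≈ f a
    ∑-single f a off = ≡.subst (λ b → ∑ f ≈ f b) to-i≡a (sum-single i λ j j≢i →
      off (Inverse.to enumeration j) (j≢i ∘ to≡a⇒≡i))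
      where
      i : Fin (size {A})
      i = Inverse.from enumeration a

      to≡a⇒≡i : ∀ {j} → Inverse.to enumeration j ≡ a → j ≡ i
      to≡a⇒≡i {j} eq = ≡.trans (≡.sym (Inverse.strictlyInverseʳ (enumeration {A}) j))
                               (≡.cong (Inverse.from enumeration) eq)

      to-i≡a : Inverse.to enumeration i ≡ a
      to-i≡a = Inverse.strictlyInverseˡ enumeration a

      sum-single : ∀ {n} {t : Fin n → Carrier} i → (∀ j → j ≢ i → t j ≈ 0#) → sum t ≈ t i
      sum-single {suc n} {t} i t≈0 = begin
        sum t                                ≈⟨ sum-remove t ⟩
        t i + sum (t ∘ punchIn i)            ≈⟨ +-congˡ (sum-cong-≋ (λ j → t≈0 (punchIn i j) (Finₚ.punchInᵢ≢i i j))) ⟩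
        t i + sum {n} (λ _ → 0#)             ≈⟨ +-congˡ (sum-replicate-zero n) ⟩
        t i + 0#                             ≈⟨ +-identityʳ (t i) ⟩
        t i                                  ∎

  -- Indicator vectors and positive semidefinite matrices

  𝟙-idem : {A : Set} (B : A → Bool) → ∀ v → 𝟙 B v * 𝟙 B v ≈ 𝟙 B v
  𝟙-idem B v with B v
  ... | true  = *-identityˡ 1#
  ... | false = zeroˡ 0#

  𝟙-* : {A : Set} (B : A → Bool) (x : Vec A) → ∀ v → 𝟙 B v * x v ≈ (if B v then x v else 0#)
  𝟙-* B x v with B v
  ... | true  = *-identityˡ (x v)
  ... | false = zeroˡ (x v)

  quadraticForm : {A : Set} {{_ : Finite A}} → Matrix A → Vec A → Carrier
  quadraticForm M z = ∑ (λ i → ∑ (λ j → z i * M i j * z j))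

  module _ {A : Set} {{_ : Finite A}} where

    -- Here `M` is the sum of the rank-one matrices of the vectors `p i` with weights `λs i`, so its
    -- form at `z` is the weighted sum of the squared inner products of `z` with the `p i`.
    gram⇒PSD : ∀ {k} {λs : Fin k → Carrier} {p : Fin k → Vec A} {M : Matrix A} →
               (∀ i → 0# ≤ λs i) → (∀ a b → M a b ≈ ∑ (λ i → λs i * (p i a * p i b))) →
               PositiveSemidefinite M
    gram⇒PSD {k} {λs} {p} {M} 0≤λ M≈ = record
      { symmetric   = λ a b → trans (M≈ a b)
          (trans (∑-congˡ λs λ i → *-comm (p i a) (p i b)) (sym (M≈ b a)))
      ; nonNegative = λ z → ≤-respʳ-≈ (sym (form z))
          (∑-nonneg λ i → *-nonneg (0≤λ i) (square-nonneg (∑ (q z i))))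
      }
      where
      module _ (z : Vec A) where
        q : Fin k → Vec A
        q i a = z a * p i a

        w : A → A → Vec (Fin k)
        w a b i = λs i * (p i a * p i b)

        t : Fin k → Matrix A
        t i a b = λs i * (q i a * q i b)

        term : ∀ i a b → z a * w a b i * z b ≈ t i a b
        term i a b = begin
          z a * (λs i * (p i a * p i b)) * z b     ≈⟨ *-congʳ (x∙yz≈y∙xz (z a) (λs i) _) ⟩
          λs i * (z a * (p i a * p i b)) * z b     ≈⟨ *-assoc (λs i) _ (z b) ⟩
          λs i * ((z a * (p i a * p i b)) * z b)   ≈⟨ *-congˡ (*-congʳ (*-assoc (z a) (p i a) (p i b))) ⟨
          λs i * ((z a * p i a * p i b) * z b)     ≈⟨ *-congˡ (*-assoc (z a * p i a) (p i b) (z b)) ⟩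
          λs i * ((z a * p i a) * (p i b * z b))   ≈⟨ *-congˡ (*-congˡ (*-comm (p i b) (z b))) ⟩
          λs i * ((z a * p i a) * (z b * p i b))   ∎

        entry : ∀ a b → z a * M a b * z b ≈ ∑ (λ i → t i a b)
        entry a b = begin
          z a * M a b * z b                ≈⟨ *-congʳ (*-congˡ (M≈ a b)) ⟩
          z a * ∑ (w a b) * z b            ≈⟨ *-congʳ (*-∑ (z a) (w a b)) ⟩
          ∑ (λ i → z a * w a b i) * z b    ≈⟨ ∑-* (z b) (λ i → z a * w a b i) ⟩
          ∑ (λ i → z a * w a b i * z b)    ≈⟨ ∑-cong (λ i → term i a b) ⟩
          ∑ (λ i → t i a b)                ∎

        factor : ∀ i → λs i * (∑ (q i) * ∑ (q i)) ≈ ∑ (λ a → ∑ (t i a))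
        factor i = begin
          λs i * (∑ (q i) * ∑ (q i))              ≈⟨ *-congˡ (∑-* (∑ (q i)) (q i)) ⟩
          λs i * ∑ (λ a → q i a * ∑ (q i))        ≈⟨ *-∑ (λs i) (λ a → q i a * ∑ (q i)) ⟩
          ∑ (λ a → λs i * (q i a * ∑ (q i)))      ≈⟨ ∑-cong row ⟩
          ∑ (λ a → ∑ (t i a))                     ∎
          where
          row : ∀ a → λs i * (q i a * ∑ (q i)) ≈ ∑ (t i a)
          row a = trans (*-congˡ (*-∑ (q i a) (q i))) (*-∑ (λs i) (λ b → q i a * q i b))

        form : quadraticForm M z ≈ ∑ (λ i → λs i * (∑ (q i) * ∑ (q i)))
        form = begin
          quadraticForm M z                            ≈⟨ ∑-cong (λ a → ∑-cong (entry a)) ⟩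
          -- The sum over `i` moves outward in two exchanges, first past `b` and then past `a`.
          ∑ (λ a → ∑ (λ b → ∑ (λ i → t i a b)))        ≈⟨ ∑-cong (λ a → ∑-swap (λ b i → t i a b)) ⟩
          ∑ (λ a → ∑ (λ i → ∑ (t i a)))                ≈⟨ ∑-swap (λ a i → ∑ (t i a)) ⟩
          ∑ (λ i → ∑ (λ a → ∑ (t i a)))                ≈⟨ ∑-cong factor ⟨
          ∑ (λ i → λs i * (∑ (q i) * ∑ (q i)))         ∎

    -- The form is evaluated at the unit vector `δ` of `a`, which leaves the single entry `M a a`.
    PSD⇒diagonal-nonneg : {M : Matrix A} → PositiveSemidefinite M → ∀ a → 0# ≤ M a a
    PSD⇒diagonal-nonneg {M} psd a = ≤-respʳ-≈ form (PositiveSemidefinite.nonNegative psd δ)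
      where
      δ : Vec A
      δ = 𝟙 (λ b → ⌊ ≟-finite b a ⌋)

      δ-off : ∀ b → b ≢ a → δ b ≈ 0#
      δ-off b b≢a with ≟-finite b a
      ... | yes b≡a = contradiction b≡a b≢a
      ... | no  _   = refl

      δ-on : δ a ≈ 1#
      δ-on with ≟-finite a a
      ... | yes _  = refl
      ... | no a≢a = contradiction ≡.refl a≢a

      entry : Matrix A
      entry b b′ = δ b * M b b′ * δ b′

      entry-off : ∀ {b} → b ≢ a → ∀ b′ → entry b b′ ≈ 0#
      entry-off {b} b≢a b′ = begin
        δ b * M b b′ * δ b′  ≈⟨ *-congʳ (*-congʳ (δ-off b b≢a)) ⟩
        0# * M b b′ * δ b′   ≈⟨ *-congʳ (zeroˡ (M b b′)) ⟩
        0# * δ b′            ≈⟨ zeroˡ (δ b′) ⟩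
        0#                   ∎

      form : quadraticForm M δ ≈ M a a
      form = begin
        quadraticForm M δ               ≈⟨ ∑-single (λ b → ∑ (entry b)) a
                                             (λ b b≢a → ∑-zero (entry-off b≢a)) ⟩
        ∑ (entry a)                     ≈⟨ ∑-single (entry a) a
                                             (λ b b≢a → trans (*-congˡ (δ-off b b≢a)) (zeroʳ _)) ⟩
        δ a * M a a * δ a               ≈⟨ *-cong (*-congʳ δ-on) δ-on ⟩
        1# * M a a * 1#                 ≈⟨ *-identityʳ _ ⟩
        1# * M a a                      ≈⟨ *-identityˡ _ ⟩
        M a a                           ∎

  -- The theta body between the stable set polytope and its clique relaxation

  module _ {V : Set} {{_ : Finite V}} (H : SimpleGraph V) where
    open SimpleGraph H

    IsStable : (V → Bool) → Set
    IsStable I = ∀ {u v} → u ∼ v → T (I u) → ¬ T (I v)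

    STAB : Pred (Vec V) (c ⊔ ℓ₁ ⊔ ℓ₂)
    STAB = conv (λ z → ∃[ I ] (IsStable I × (∀ v → z v ≈ 𝟙 I v)))

    TH⊆QSTAB : TH H ⊆ QSTAB H
    TH⊆QSTAB {x} (X , X-sym , psd , diag , edge) =
      -- Each coordinate of `x` is a diagonal entry of the bordered matrix.
      (λ v → ≤-respʳ-≈ (diag v) (PSD⇒diagonal-nonneg psd (inj₂ v))) , clique
      where
      clique : ∀ K → IsClique K → ∑ (λ v → if K v then x v else 0#) ≤ 1#
      clique K isClique = 0≤y-x⇒x≤y (≤-respʳ-≈ form (PositiveSemidefinite.nonNegative psd z))
        where
        k : Vec V
        k = 𝟙 K

        z : Vec (⊤ ⊎ V)
        z (inj₁ _) = 1#
        z (inj₂ v) = - k v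

        -- Outside `K` a factor of the indicator vanishes; two distinct vertices of the clique are
        -- adjacent, so there the entry of `X` vanishes.
        off : ∀ u v → v ≢ u → k u * X u v * k v ≈ 0#
        off u v v≢u with K u in u∈K | K v in v∈K
        ... | false | _     = trans (*-congʳ (zeroˡ _)) (zeroˡ _)
        ... | true  | false = zeroʳ _
        ... | true  | true  = begin
          1# * X u v * 1#  ≈⟨ *-congʳ (*-congˡ (edge u v (isClique u v
                                (≡.subst T (≡.sym u∈K) tt) (≡.subst T (≡.sym v∈K) tt) (v≢u ∘ ≡.sym)))) ⟩
          1# * 0# * 1#     ≈⟨ *-congʳ (zeroʳ 1#) ⟩
          0# * 1#          ≈⟨ zeroˡ 1# ⟩
          0#               ∎

        on : ∀ u → k u * X u u * k u ≈ k u * x u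
        on u = begin
          k u * X u u * k u    ≈⟨ *-assoc (k u) (X u u) (k u) ⟩
          k u * (X u u * k u)  ≈⟨ *-congˡ (*-comm (X u u) (k u)) ⟩
          k u * (k u * X u u)  ≈⟨ *-assoc (k u) (k u) (X u u) ⟨
          k u * k u * X u u    ≈⟨ *-cong (𝟙-idem K u) (diag u) ⟩
          k u * x u            ∎

        -- Within the clique only the diagonal of X survives, and it cancels
        -- against the border.
        row : ∀ u → - k u * x u * 1# + ∑ (λ v → - k u * X u v * - k v) ≈ 0#
        row u = begin
          - k u * x u * 1# + ∑ (λ v → - k u * X u v * - k v)
            ≈⟨ +-cong (trans (*-identityʳ _) (sym (-‿distribˡ-* (k u) (x u))))
                      (∑-cong (λ v → trans (*-congʳ (sym (-‿distribˡ-* (k u) (X u v)))) (-x*-y≈x*y _ (k v)))) ⟩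
          - (k u * x u) + ∑ (λ v → k u * X u v * k v)
            ≈⟨ +-congˡ (trans (∑-single (λ v → k u * X u v * k v) u (off u)) (on u)) ⟩
          - (k u * x u) + k u * x u
            ≈⟨ -‿inverseˡ (k u * x u) ⟩
          0# ∎

        topRow : 1# * 1# * 1# + ∑ (λ v → 1# * x v * - k v) ≈ 1# - ∑ (λ v → if K v then x v else 0#)
        topRow = +-cong (trans (*-identityʳ _) (*-identityʳ _)) (begin
          ∑ (λ v → 1# * x v * - k v)                 ≈⟨ ∑-cong (λ v → begin
            1# * x v * - k v                            ≈⟨ *-congʳ (*-identityˡ (x v)) ⟩
            x v * - k v                                 ≈⟨ -‿distribʳ-* (x v) (k v) ⟨
            - (x v * k v)                               ≈⟨ -‿cong (trans (*-comm (x v) (k v)) (𝟙-* K x v)) ⟩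
            - (if K v then x v else 0#)                 ∎) ⟩
          ∑ (λ v → - (if K v then x v else 0#))      ≈⟨ -‿∑ (λ v → if K v then x v else 0#) ⟨
          - ∑ (λ v → if K v then x v else 0#)        ∎)

        -- The border row alone contributes `1#` minus the weight of `K`; every other row sums to
        -- zero.
        form : quadraticForm (bordered x X) z ≈ 1# - ∑ (λ v → if K v then x v else 0#)
        form = begin
          -- The enumeration of `⊤ ⊎ V` lists the border index first, so each sum splits by
          -- computation into the border term and a sum over `V`.
          quadraticForm (bordered x X) z ≡⟨⟩
          (1# * 1# * 1# + ∑ (λ v → 1# * x v * - k v))
            + ∑ (λ u → - k u * x u * 1# + ∑ (λ v → - k u * X u v * - k v))
            ≈⟨ +-cong topRow (∑-zero row) ⟩
          (1# - ∑ (λ v → if K v then x v else 0#)) + 0#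
            ≈⟨ +-identityʳ _ ⟩
          1# - ∑ (λ v → if K v then x v else 0#) ∎

    STAB⊆TH : STAB ⊆ TH H
    STAB⊆TH {x} (n , λs , points , stable , 0≤λ , ∑λ≈1 , x≈) =
      X , (λ u v → ∑-congˡ λs λ i → *-comm (χ i u) (χ i v)) , gram⇒PSD 0≤λ entries , diag , edge
      where
      -- The given points equal indicators only up to `_≈_`; the indicators themselves allow case
      -- analysis on membership.
      χ : Fin n → Vec V
      χ i = 𝟙 (proj₁ (stable i))

      X : Matrix V
      X u v = ∑ (λ i → λs i * (χ i u * χ i v))

      x≈∑χ : ∀ v → x v ≈ ∑ (λ i → λs i * χ i v)
      x≈∑χ v = trans (x≈ v) (∑-congˡ λs λ i → proj₂ (proj₂ (stable i)) v)

      homogenised : Fin n → Vec (⊤ ⊎ V)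
      homogenised i (inj₁ _) = 1#
      homogenised i (inj₂ v) = χ i v

      entries : ∀ a b → bordered x X a b ≈ ∑ (λ i → λs i * (homogenised i a * homogenised i b))
      -- The corner entry is the total weight, which is why the coefficients must sum to one.
      entries (inj₁ _) (inj₁ _) =
        trans (sym ∑λ≈1) (∑-cong λ i → sym (trans (*-congˡ (*-identityʳ 1#)) (*-identityʳ (λs i))))
      entries (inj₁ _) (inj₂ v) = trans (x≈∑χ v) (∑-congˡ λs λ i → sym (*-identityˡ (χ i v)))
      entries (inj₂ u) (inj₁ _) = trans (x≈∑χ u) (∑-congˡ λs λ i → sym (*-identityʳ (χ i u)))
      entries (inj₂ u) (inj₂ v) = refl

      diag : ∀ v → X v v ≈ x v
      diag v = trans (∑-congˡ λs λ i → 𝟙-idem (proj₁ (stable i)) v) (sym (x≈∑χ v))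

      χ-edge : ∀ i {u v} → u ∼ v → χ i u * χ i v ≈ 0#
      χ-edge i {u} {v} u∼v with I , isStable , _ ← stable i with I u in u∈I | I v in v∈I
      ... | false | _     = zeroˡ _
      ... | true  | false = zeroʳ _
      ... | true  | true  =
        contradiction (≡.subst T (≡.sym v∈I) tt) (isStable u∼v (≡.subst T (≡.sym u∈I) tt))

      edge : ∀ u v → u ∼ v → X u v ≈ 0#
      edge u v u∼v = ∑-zero λ i → trans (*-congˡ (χ-edge i u∼v)) (zeroʳ (λs i))

  -- Projecting the inclusions to the signed bodies

  module _ {V E : Set} {{_ : Finite V}} {{_ : Finite E}} (G : SignedGraph V E) where

    -- Over a vertex of `B` the lift contains exactly one of the two signed copies, and over any
    -- other vertex none.
    proj-stableLift : ∀ B s (v : V) → proj (𝟙 (stableLift G B s)) v ≈ 𝟙 B v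
    proj-stableLift B s v with B v | s v
    ... | true  | Sign.+ = +-identityʳ 1#
    ... | true  | Sign.- = +-identityˡ 1#
    ... | false | _      = +-identityʳ 0#

    -- Each balanced set is lifted to a stable set and the coefficients are kept; since the
    -- projection is linear, the lifted combination maps back to `x`.
    BSTAB⊆p[STAB] : BSTAB G ⊆ projImage (STAB (conflictGraph G))
    BSTAB⊆p[STAB] {x} (n , λs , points , balanced , 0≤λ , ∑λ≈1 , x≈) =
      y , (n , λs , (λ i → 𝟙 (I i)) , (λ i → I i , stable i , λ _ → refl) , 0≤λ , ∑λ≈1 , λ _ → refl) , proj-y≈x
      where
      lift : ∀ i → _
      lift i = balancedSet⇒stable G (proj₁ (balanced i)) (proj₁ (proj₂ (balanced i)))

      I : Fin n → V × Sign → Bool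
      I i = stableLift G (proj₁ (balanced i)) (proj₁ (lift i))

      stable : ∀ i → IsStable (conflictGraph G) (I i)
      stable i = proj₂ (lift i)

      y : Vec (V × Sign)
      y a = ∑ (λ i → λs i * 𝟙 (I i) a)

      proj-y≈x : ∀ v → proj y v ≈ x v
      proj-y≈x v = begin
        proj y v                                    ≈⟨ ∑-+ {A = Fin n} _ _ ⟨
        ∑ (λ i → λs i * 𝟙 (I i) (v , Sign.+) + λs i * 𝟙 (I i) (v , Sign.-))
                                                    ≈⟨ ∑-cong (λ i → distribˡ (λs i) _ _) ⟨
        ∑ (λ i → λs i * proj (𝟙 (I i)) v)           ≈⟨ ∑-congˡ λs (λ i → trans
                                                         (proj-stableLift (proj₁ (balanced i)) (proj₁ (lift i)) v)
                                                         (sym (proj₂ (proj₂ (balanced i)) v))) ⟩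
        ∑ (λ i → λs i * points i v)                 ≈⟨ x≈ v ⟨
        x v                                         ∎

    projImage-mono : ∀ {p q} {P : Pred (Vec (V × Sign)) p} {Q : Pred (Vec (V × Sign)) q} →
                     P ⊆ Q → projImage P ⊆ projImage Q
    projImage-mono P⊆Q (y , y∈P , py≈x) = y , P⊆Q y∈P , py≈x

    BSTAB⊆BTH : BSTAB G ⊆ BTH G
    BSTAB⊆BTH = projImage-mono (STAB⊆TH (conflictGraph G)) ∘ BSTAB⊆p[STAB]

    BTH⊆BQSTAB : BTH G ⊆ BQSTAB G
    BTH⊆BQSTAB = projImage-mono (TH⊆QSTAB (conflictGraph G))

mainTheorem4 : ∀ {c ℓ₁ ℓ₂} (ℝ : RealField c ℓ₁ ℓ₂) {V E : Set} {{_ : Finite V}} {{_ : Finite E}}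
    (Σ : SignedGraph V E) →
    let open Bodies ℝ in
    (BSTAB (completion Σ) ⊆ BTH (completion Σ)) × (BTH (completion Σ) ⊆ BQSTAB (completion Σ))
mainTheorem4 ℝ Σ = BSTAB⊆BTH (completion Σ) , BTH⊆BQSTAB (completion Σ)
  where open RealProperties ℝ
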